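{- Let $k \geq 6$ and $r \geq 3$ be integers. Every graph $G$ with average degree at least $\tfrac{4}{3}kr$ contains $k$ pairwise vertex-disjoint cycles, each containing at least $r$ vertices.
   Context: Graphs are finite and simple. The average degree of a graph $G$ is $d(G) = 2|E(G)|/|V(G)|$. -}

module Defs where

open import Data.Nat using (ℕ; zero; suc; _+_; _*_; _≤_; _<_)
open import Data.Fin using (Fin; toℕ)
open import Data.Bool using (Bool; true; false)
open import Data.List using (List; []; _∷_; length; filter; concat; map; allFin; cartesianProduct; last; head)
open import Data.Vec.Functional using (Vector)
open import Data.Product using (_×_; _,_; proj₁; proj₂; Σ)
open import Data.Maybe using (Maybe; just; nothing)
open import Data.List.Relation.Unary.Unique.Propositional using (Unique)
open import Relation.Binary.PropositionalEquality using (_≡_)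
open import Relation.Nullary using (¬_)
open import Relation.Nullary.Decidable using (⌊_⌋)
open import Data.Fin.Properties using () renaming (_<?_ to _<ᶠ?_)
open import Data.Bool using (_∧_)

record Graph (n : ℕ) : Set where
  field
    adj   : Fin n → Fin n → Bool
    sym   : ∀ i j → adj i j ≡ adj j i
    irrefl : ∀ i → adj i i ≡ false

open Graph public

Adj : ∀ {n} → Graph n → Fin n → Fin n → Set
Adj G i j = adj G i j ≡ true

edges : ∀ {n} → Graph n → List (Fin n × Fin n)
edges {n} G =
  filter (λ p → Data.Bool._≟_ (⌊ proj₁ p <ᶠ? proj₂ p ⌋ ∧ adj G (proj₁ p) (proj₂ p)) true)
         (cartesianProduct (allFin n) (allFin n))

numEdges : ∀ {n} → Graph n → ℕ
numEdges G = length (edges G)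

data Path {n} (G : Graph n) : List (Fin n) → Set where
  nil  : Path G []
  one  : ∀ v → Path G (v ∷ [])
  cons : ∀ u v vs → Adj G u v → Path G (v ∷ vs) → Path G (u ∷ v ∷ vs)

record IsCycle {n} (G : Graph n) (vs : List (Fin n)) : Set where
  field
    len≥3    : 3 ≤ length vs
    distinct : Unique vs
    path     : Path G vs
    closing  : Σ (Fin n) λ a → Σ (Fin n) λ b →
                 (head vs ≡ just a) × (last vs ≡ just b) × Adj G b a

record DisjointLongCycles {n} (G : Graph n) (k r : ℕ) : Set where
  field
    cycles   : Vector (List (Fin n)) k
    isCycle  : ∀ i → IsCycle G (cycles i)
    long     : ∀ i → r ≤ length (cycles i)
    disjoint : Unique (concat (Data.List.map cycles (allFin k)))

{-# OPTIONS --safe #-}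

-- With m = ⌈r/2⌉, already |E| ≥ (km + r − 3) n forces k disjoint cycles of length ≥ r; for k ≥ 6
-- this is implied by 2|E| ≥ (4/3) k r n.  Induct on k, then on n, with c = km + r − 3.
-- An edge with fewer than c common neighbours is contracted: the density is kept, and cycles of the
-- minor lift to cycles that are at least as long.  So every edge has c common neighbours.  Call a
-- vertex high if its degree is at least n/2 + km − 1; two high vertices have at least 2km − 2 common
-- neighbours.  If there are km high vertices, link them greedily through common neighbours into k
-- alternating cycles of length 2m.  Otherwise there is an edge between low vertices, and every such
-- edge has c − (km − 1) = r − 2 low common neighbours, so inserting these one at a time gives a cycle
-- of exactly r low vertices; deleting it leaves a graph dense enough for k − 1.
module Submission where

open import Defs
open import Data.Nat using (ℕ; zero; suc; _+_; _*_; _∸_; _≤_; _<_; z≤n; s≤s; NonZero; ⌈_/2⌉)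
open import Data.Nat.Properties hiding (_≟_)
open import Algebra.Properties.CommutativeSemigroup +-commutativeSemigroup using (interchange; x∙yz≈y∙xz)
open import Data.Nat.Tactic.RingSolver using (solve-∀)
open import Data.Bool using (Bool; true; false; not; _∧_; _∨_)
open import Data.Bool.Properties using (∧-comm)
open import Data.Fin using (Fin; zero; suc)
open import Data.Fin.Properties using (_≟_) renaming (_<?_ to _<ᶠ?_)
open import Data.Maybe using (just)
open import Data.List using (List; []; _∷_; _++_; length; concat; filter; take; drop; map; last; lookup; allFin; cartesianProduct)
open import Data.List.Properties
  using (length-++; length-take; length-drop; take++drop≡id; ++-assoc; ++-identityʳ; filter-++;
         map-tabulate; tabulate-lookup; length-tabulate)
open import Data.List.Membership.Propositional using (_∈_; _∉_; find; lose)
open import Data.List.Membership.Propositional.Properties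
  using (∈-∃++; ∈-++⁺ˡ; ∈-++⁺ʳ; ∈-++⁻; ∈-filter⁺; ∈-filter⁻; ∈-lookup)
open import Data.List.Relation.Unary.Any using (here; there; any?)
open import Data.List.Relation.Unary.All as All using (All; []; _∷_)
open import Data.List.Relation.Unary.AllPairs using ([]; _∷_)
open import Data.List.Relation.Unary.Unique.Propositional using (Unique)
import Data.List.Relation.Unary.Unique.Propositional.Properties as Uniq
open import Data.List.Relation.Binary.Permutation.Propositional
open import Data.List.Relation.Binary.Permutation.Propositional.Properties
  using (∈-resp-↭; ↭-length; shift; ++-comm; ++⁺; ++⁺ˡ; shifts)
import Data.List.Relation.Binary.Permutation.Setoid.Properties as Permutationₛ
open import Data.Product using (_×_; _,_; proj₁; proj₂; ∃; ∃₂)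
open import Data.Sum using (_⊎_; inj₁; inj₂; [_,_]′)
open import Data.Empty using (⊥)
open import Function using (_∘_; flip)
open import Relation.Nullary using (yes; no; Dec; contradiction)
open import Relation.Nullary.Decidable using (⌊_⌋; _×-dec_; ¬?)
open import Relation.Binary.PropositionalEquality as ≡ using (_≡_; _≢_; refl; cong; cong₂; subst; subst₂)

private
  variable
    N : ℕ

-- Lists without repetition, up to permutation.

module _ {A : Set} where

  Unique-resp-↭ : {xs ys : List A} → xs ↭ ys → Unique xs → Unique ys
  Unique-resp-↭ p = Permutationₛ.Unique-resp-↭ (≡.setoid A) (↭⇒↭ₛ p)

  Unique-++⁻ʳ : (xs : List A) {ys : List A} → Unique (xs ++ ys) → Unique ys
  Unique-++⁻ʳ [] u = u
  Unique-++⁻ʳ (x ∷ xs) (_ ∷ u) = Unique-++⁻ʳ xs u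

  Unique-++⁻ˡ : (xs : List A) {ys : List A} → Unique (xs ++ ys) → Unique xs
  Unique-++⁻ˡ xs {ys} u = Unique-++⁻ʳ ys (Unique-resp-↭ (++-comm xs ys) u)

  Unique-disjoint : (xs : List A) {ys : List A} {z : A} → Unique (xs ++ ys) → z ∈ xs → z ∉ ys
  Unique-disjoint (x ∷ xs) (x∉ ∷ u) (here refl) z∈ys = All.lookup x∉ (∈-++⁺ʳ xs z∈ys) refl
  Unique-disjoint (x ∷ xs) (x∉ ∷ u) (there z∈xs) z∈ys = Unique-disjoint xs u z∈xs z∈ys

  ∉⇒All≢ : {x : A} {xs : List A} → x ∉ xs → All (x ≢_) xs
  ∉⇒All≢ x∉ = All.tabulate λ {y} y∈ x≡y → x∉ (subst (_∈ _) (≡.sym x≡y) y∈)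

  ∈⇒↭∷ : {x : A} {xs : List A} → x ∈ xs → ∃ λ ys → xs ↭ x ∷ ys
  ∈⇒↭∷ x∈ with ys , zs , refl ← ∈-∃++ x∈ = ys ++ zs , shift _ ys zs

  -- Serves as set difference for vertex sets kept as lists: each entry of `xs` is pulled out of
  -- what remains of `ys`. The permutation then transports counts and `Unique` to the two pieces.
  complement : (xs : List A) {ys : List A} → Unique xs → (∀ {z} → z ∈ xs → z ∈ ys) →
               ∃ λ zs → ys ↭ xs ++ zs
  complement [] _ _ = _ , refl
  complement (x ∷ xs) u@(x∉ ∷ u′) xs⊆ys
    with zs , p ← complement xs u′ (xs⊆ys ∘ there)
    with ∈-++⁻ xs (∈-resp-↭ p (xs⊆ys (here refl)))
  ... | inj₁ x∈xs = contradiction x∈xs (Uniq.Unique[x∷xs]⇒x∉xs u)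
  ... | inj₂ x∈zs with zs′ , p′ ← ∈⇒↭∷ x∈zs =
    zs′ , trans p (trans (++⁺ˡ xs p′) (shift x xs zs′))

-- Counting

bit : Bool → ℕ
bit true  = 1
bit false = 0

bit≤1 : ∀ b → bit b ≤ 1
bit≤1 true  = s≤s z≤n
bit≤1 false = z≤n

module _ {A : Set} where

  count : (A → Bool) → List A → ℕ
  count p []       = 0
  count p (x ∷ xs) = bit (p x) + count p xs

  count-++ : ∀ p xs ys → count p (xs ++ ys) ≡ count p xs + count p ys
  count-++ p [] ys = refl
  count-++ p (x ∷ xs) ys =
    ≡.trans (cong (bit (p x) +_) (count-++ p xs ys)) (≡.sym (+-assoc (bit (p x)) _ _))

  count-↭ : ∀ p {xs ys} → xs ↭ ys → count p xs ≡ count p ys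
  count-↭ p refl = refl
  count-↭ p (prep x q) = cong (bit (p x) +_) (count-↭ p q)
  count-↭ p (swap {xs} {ys} x y q) =
    ≡.trans (cong (λ t → bit (p x) + (bit (p y) + t)) (count-↭ p q))
            (x∙yz≈y∙xz (bit (p x)) (bit (p y)) (count p ys))
  count-↭ p (trans q q′) = ≡.trans (count-↭ p q) (count-↭ p q′)

  count-≤-length : ∀ p xs → count p xs ≤ length xs
  count-≤-length p [] = z≤n
  count-≤-length p (x ∷ xs) = +-mono-≤ (bit≤1 (p x)) (count-≤-length p xs)

  count-cong : ∀ {p q} xs → (∀ {x} → x ∈ xs → p x ≡ q x) → count p xs ≡ count q xs
  count-cong [] eq = refl
  count-cong (x ∷ xs) eq = cong₂ _+_ (cong bit (eq (here refl))) (count-cong xs (eq ∘ there))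

  count-not : ∀ p xs → count p xs + count (not ∘ p) xs ≡ length xs
  count-not p [] = refl
  count-not p (x ∷ xs) with p x
  ... | true  = cong suc (count-not p xs)
  ... | false = ≡.trans (+-suc _ _) (cong suc (count-not p xs))

  -- Inclusion-exclusion, checked entry by entry. It yields both the codegree of two high vertices
  -- and the degree of a contracted vertex.
  count-∨-∧ : ∀ p q xs → count (λ x → p x ∨ q x) xs + count (λ x → p x ∧ q x) xs
                         ≡ count p xs + count q xs
  count-∨-∧ p q [] = refl
  count-∨-∧ p q (x ∷ xs) =
    ≡.trans (interchange (bit (p x ∨ q x)) _ _ _)
    (≡.trans (cong₂ _+_ (bits (p x) (q x)) (count-∨-∧ p q xs)) (≡.sym (interchange (bit (p x)) _ _ _)))
    where
    bits : ∀ a b → bit (a ∨ b) + bit (a ∧ b) ≡ bit a + bit b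
    bits true  true  = refl
    bits true  false = refl
    bits false true  = refl
    bits false false = refl

  -- Every counted entry of `xs` is matched with an entry of `ys` that is then removed; as `xs` has
  -- no repetitions, the later entries still find their match.
  count-⊆ : ∀ p {xs} ys → Unique xs → (∀ {x} → x ∈ xs → p x ≡ true → x ∈ ys) →
            count p xs ≤ count p ys
  count-⊆ p ys [] _ = z≤n
  count-⊆ p {x ∷ xs} ys (x∉ ∷ u) xs⊆ys with p x in px
  ... | false = count-⊆ p ys u (xs⊆ys ∘ there)
  ... | true with ys′ , q ← ∈⇒↭∷ (xs⊆ys (here refl) px) = begin
    suc (count p xs)  ≤⟨ s≤s (count-⊆ p ys′ u xs⊆ys′) ⟩
    suc (count p ys′) ≡⟨ cong (λ b → bit b + count p ys′) px ⟨
    count p (x ∷ ys′) ≡⟨ count-↭ p q ⟨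
    count p ys        ∎
    where
    open ≤-Reasoning
    xs⊆ys′ : ∀ {z} → z ∈ xs → p z ≡ true → z ∈ ys′
    xs⊆ys′ z∈ pz with ∈-resp-↭ q (xs⊆ys (there z∈) pz)
    ... | here z≡x = contradiction (≡.sym z≡x) (All.lookup x∉ z∈)
    ... | there z∈ys′ = z∈ys′

  -- The entries failing `p` include `x` and `y`, and the two counts add up to the length. Applied
  -- to common neighbours of `x` and `y`, since neither vertex is its own neighbour; the gain of 2
  -- matters in `link` and `order`.
  count-misses-two : ∀ p {x y} ys → x ≢ y → x ∈ ys → y ∈ ys → p x ≡ false → p y ≡ false →
                     2 + count p ys ≤ length ys
  count-misses-two p {x} {y} ys x≢y x∈ y∈ px py = begin
    2 + count p ys                             ≡⟨ +-comm 2 _ ⟩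
    count p ys + 2                             ≤⟨ +-monoʳ-≤ (count p ys) two ⟩
    count p ys + count (not ∘ p) ys            ≡⟨ count-not p ys ⟩
    length ys                                  ∎
    where
    open ≤-Reasoning
    pair : count (not ∘ p) (x ∷ y ∷ []) ≡ 2
    pair rewrite px | py = refl
    two : 2 ≤ count (not ∘ p) ys
    two = subst (_≤ count (not ∘ p) ys) pair
      (count-⊆ (not ∘ p) {x ∷ y ∷ []} ys ((x≢y ∷ []) ∷ [] ∷ [])
        λ { (here refl) _ → x∈ ; (there (here refl)) _ → y∈ })

  -- Ordered pairs: pairs (adj G) W W is twice the number of edges induced on W.
  pairs : (A → A → Bool) → List A → List A → ℕ
  pairs R []       ys = 0
  pairs R (x ∷ xs) ys = count (R x) ys + pairs R xs ys

  pairs-++ˡ : ∀ R xs xs′ ys → pairs R (xs ++ xs′) ys ≡ pairs R xs ys + pairs R xs′ ys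
  pairs-++ˡ R [] xs′ ys = refl
  pairs-++ˡ R (x ∷ xs) xs′ ys =
    ≡.trans (cong (count (R x) ys +_) (pairs-++ˡ R xs xs′ ys)) (≡.sym (+-assoc (count (R x) ys) _ _))

  -- Double counting: summation by rows against summation by columns.
  pairs-flip : ∀ R xs ys → pairs R xs ys ≡ pairs (flip R) ys xs
  pairs-flip R [] [] = refl
  pairs-flip R [] (y ∷ ys) = pairs-flip R [] ys
  pairs-flip R (x ∷ xs) ys = ≡.trans (cong (count (R x) ys +_) (pairs-flip R xs ys)) (column ys)
    where
    column : ∀ ys → count (R x) ys + pairs (flip R) ys xs ≡ pairs (flip R) ys (x ∷ xs)
    column [] = refl
    column (y ∷ ys) = ≡.trans (interchange (bit (R x y)) _ _ _) (cong (bit (R x y) + count (flip R y) xs +_) (column ys))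

  pairs-cong : ∀ {R S} xs ys → (∀ {x y} → x ∈ xs → y ∈ ys → R x y ≡ S x y) →
               pairs R xs ys ≡ pairs S xs ys
  pairs-cong [] ys eq = refl
  pairs-cong (x ∷ xs) ys eq =
    cong₂ _+_ (count-cong ys (eq (here refl))) (pairs-cong xs ys (eq ∘ there))

  pairs-↭ˡ : ∀ R {xs xs′} ys → xs ↭ xs′ → pairs R xs ys ≡ pairs R xs′ ys
  pairs-↭ˡ R ys refl = refl
  pairs-↭ˡ R ys (prep x p) = cong (count (R x) ys +_) (pairs-↭ˡ R ys p)
  pairs-↭ˡ R ys (swap {xs} {xs′} x y p) =
    ≡.trans (cong (λ t → count (R x) ys + (count (R y) ys + t)) (pairs-↭ˡ R ys p))
            (x∙yz≈y∙xz (count (R x) ys) (count (R y) ys) (pairs R xs′ ys))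
  pairs-↭ˡ R ys (trans p q) = ≡.trans (pairs-↭ˡ R ys p) (pairs-↭ˡ R ys q)

  pairs-↭ : ∀ R {xs ys} → xs ↭ ys → pairs R xs xs ≡ pairs R ys ys
  pairs-↭ R {xs} {ys} p = ≡.trans (pairs-↭ˡ R xs p)
    (≡.trans (pairs-flip R ys xs) (≡.trans (pairs-↭ˡ (flip R) ys p) (≡.sym (pairs-flip R ys ys))))

  pairs-++ʳ : ∀ R xs ys ys′ → pairs R xs (ys ++ ys′) ≡ pairs R xs ys + pairs R xs ys′
  pairs-++ʳ R xs ys ys′ = ≡.trans (pairs-flip R xs (ys ++ ys′))
    (≡.trans (pairs-++ˡ (flip R) ys ys′ xs)
      (cong₂ _+_ (≡.sym (pairs-flip R xs ys)) (≡.sym (pairs-flip R xs ys′))))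

  pairs-≤-* : ∀ R xs ys → pairs R xs ys ≤ length xs * length ys
  pairs-≤-* R [] ys = z≤n
  pairs-≤-* R (x ∷ xs) ys = +-mono-≤ (count-≤-length (R x) ys) (pairs-≤-* R xs ys)

  count-witness : ∀ p xs → 1 ≤ count p xs → ∃ λ x → x ∈ xs × p x ≡ true
  count-witness p (x ∷ xs) pos with p x in px
  ... | true = x , here refl , px
  ... | false with y , y∈ , py ← count-witness p xs pos = y , there y∈ , py

  pairs-witness : ∀ R xs ys → 1 ≤ pairs R xs ys →
                  ∃₂ λ x y → x ∈ xs × y ∈ ys × R x y ≡ true
  pairs-witness R (x ∷ xs) ys pos with count (R x) ys in eq
  ... | suc n with y , y∈ , Rxy ← count-witness (R x) ys (subst (1 ≤_) (≡.sym eq) (s≤s z≤n)) =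
    x , y , here refl , y∈ , Rxy
  ... | zero with x′ , y , x∈ , y∈ , Rxy ← pairs-witness R xs ys pos = x′ , y , there x∈ , y∈ , Rxy

-- Pigeonhole: if `ys` contained every such entry of `xs`, then `count-⊆` would contradict the
-- strict inequality.
fresh : ∀ (p : Fin N → Bool) {xs} ys → Unique xs → count p ys < count p xs →
        ∃ λ x → x ∈ xs × p x ≡ true × x ∉ ys
fresh p {xs} ys u lt with any? (λ x → (p x Data.Bool.≟ true) ×-dec ¬? (any? (x ≟_) ys)) xs
... | yes w with x , x∈ , px , x∉ ← find w = x , x∈ , px , x∉
... | no ¬w = contradiction lt (≤⇒≯ (count-⊆ p ys u covered))
  where
  covered : ∀ {x} → x ∈ xs → p x ≡ true → x ∈ ys
  covered {x} x∈ px with any? (x ≟_) ys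
  ... | yes x∈ys = x∈ys
  ... | no  x∉ys = contradiction (lose x∈ (px , x∉ys)) ¬w

-- Degrees, common neighbours and walks.

module _ (G : Graph N) where

  deg : List (Fin N) → Fin N → ℕ
  deg W x = count (adj G x) W

  common : Fin N → Fin N → Fin N → Bool
  common x y z = adj G x z ∧ adj G y z

  Adj-sym : ∀ {x y} → Adj G x y → Adj G y x
  Adj-sym {x} {y} = ≡.trans (Graph.sym G y x)

  Adj⇒≢ : ∀ {x y} → Adj G x y → x ≢ y
  Adj⇒≢ {x} xy refl = contradiction (≡.trans (≡.sym xy) (irrefl G x)) λ ()

  common⇒Adj : ∀ x y {z} → common x y z ≡ true → Adj G x z × Adj G y z
  common⇒Adj x y {z} eq with adj G x z | adj G y z
  ... | true | true = refl , refl

  common-irreflˡ : ∀ x y → common x y x ≡ false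
  common-irreflˡ x y rewrite irrefl G x = refl

  common-irreflʳ : ∀ x y → common x y y ≡ false
  common-irreflʳ x y = ≡.trans (∧-comm (adj G x y) _) (common-irreflˡ y x)

  pairs-sym : ∀ xs ys → pairs (adj G) xs ys ≡ pairs (adj G) ys xs
  pairs-sym xs ys = ≡.trans (pairs-flip (adj G) xs ys) (pairs-cong ys xs λ {x} {y} _ _ → Graph.sym G y x)

  pairs-++ : ∀ xs ys → pairs (adj G) (xs ++ ys) (xs ++ ys) ≡
             pairs (adj G) xs (xs ++ ys) + (pairs (adj G) xs ys + pairs (adj G) ys ys)
  pairs-++ xs ys = ≡.trans (pairs-++ˡ (adj G) xs ys (xs ++ ys))
    (cong (pairs (adj G) xs (xs ++ ys) +_)
      (≡.trans (pairs-++ʳ (adj G) ys xs ys) (cong (_+ pairs (adj G) ys ys) (pairs-sym ys xs))))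

  -- Bounds what is lost when `xs` is deleted: every edge meeting `xs` shows up in the degree sum of
  -- `xs`. Edges inside `xs` show up there twice, whence an inequality.
  pairs-++-≤ : ∀ xs ys → pairs (adj G) (xs ++ ys) (xs ++ ys) ≤
               2 * pairs (adj G) xs (xs ++ ys) + pairs (adj G) ys ys
  pairs-++-≤ xs ys = begin
    pairs (adj G) (xs ++ ys) (xs ++ ys) ≡⟨ pairs-++ xs ys ⟩
    s + (pairs (adj G) xs ys + t)       ≤⟨ +-monoʳ-≤ s (+-monoˡ-≤ t (m≤n+m _ (pairs (adj G) xs xs))) ⟩
    s + (pairs (adj G) xs xs + pairs (adj G) xs ys + t) ≡⟨ cong (λ z → s + (z + t)) (pairs-++ʳ (adj G) xs xs ys) ⟨
    s + (s + t)                         ≡⟨ lemma s t ⟩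
    2 * s + t                           ∎
    where
    open ≤-Reasoning
    s = pairs (adj G) xs (xs ++ ys)
    t = pairs (adj G) ys ys
    lemma : ∀ s t → s + (s + t) ≡ 2 * s + t
    lemma = solve-∀

  -- The list holds the interior vertices only, so a cycle is a walk from its first vertex through
  -- the others back to the first, closing edge included.
  Walk : Fin N → List (Fin N) → Fin N → Set
  Walk x []       z = Adj G x z
  Walk x (y ∷ ys) z = Adj G x y × Walk y ys z

  Walk-++⁺ : ∀ {x} ys {y} zs {z} → Walk x ys y → Walk y zs z → Walk x (ys ++ y ∷ zs) z
  Walk-++⁺ [] zs a w = a , w
  Walk-++⁺ (_ ∷ ys) zs (a , v) w = a , Walk-++⁺ ys zs v w

  Walk-++⁻ : ∀ {x} ys {y} zs {z} → Walk x (ys ++ y ∷ zs) z → Walk x ys y × Walk y zs z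
  Walk-++⁻ [] zs w = w
  Walk-++⁻ (_ ∷ ys) zs (a , w) with v , w′ ← Walk-++⁻ ys zs w = (a , v) , w′

  ClosedWalk : List (Fin N) → Set
  ClosedWalk []       = ⊥
  ClosedWalk (x ∷ xs) = Walk x xs x

  -- Splitting at `y` gives two walks, which are joined in the other order. This lets a cycle start
  -- at the contracted vertex.
  rotate : ∀ xs {y} ys → ClosedWalk (xs ++ y ∷ ys) → ClosedWalk (y ∷ ys ++ xs)
  rotate [] ys w = subst (λ l → Walk _ l _) (≡.sym (++-identityʳ ys)) w
  rotate (x ∷ xs) ys w with v , w′ ← Walk-++⁻ xs ys w = Walk-++⁺ ys xs w′ v

-- `W` stands for an induced subgraph, so deletion and contraction can stay within `Fin N`.
-- Uniqueness of the concatenation says both that each cycle is simple and that the cycles are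
-- disjoint.
record Packing (G : Graph N) (k r : ℕ) (W : List (Fin N)) : Set where
  constructor packing
  field
    cycles   : List (List (Fin N))
    number   : length cycles ≡ k
    closed   : All (λ c → ClosedWalk G c × r ≤ length c) cycles
    distinct : Unique (concat cycles)
    within   : ∀ {z} → z ∈ concat cycles → z ∈ W



-- Contracting an edge and lifting cycles back.

-- The vertex type is kept: v is only to be left out of the vertex list.
contract : Graph N → Fin N → Fin N → Graph N
contract {N} G u v = record { adj = adj′ ; sym = sym′ ; irrefl = irrefl′ }
  where
  adj′ : Fin N → Fin N → Bool
  adj′ x y with x ≟ u | y ≟ u
  ... | yes _ | yes _ = false
  ... | yes _ | no _  = adj G u y ∨ adj G v y
  ... | no _  | yes _ = adj G u x ∨ adj G v x
  ... | no _  | no _  = adj G x y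
  sym′ : ∀ x y → adj′ x y ≡ adj′ y x
  sym′ x y with x ≟ u | y ≟ u
  ... | yes _ | yes _ = refl
  ... | yes _ | no _  = refl
  ... | no _  | yes _ = refl
  ... | no _  | no _  = Graph.sym G x y
  irrefl′ : ∀ x → adj′ x x ≡ false
  irrefl′ x with x ≟ u
  ... | yes _ = refl
  ... | no _  = irrefl G x

module _ (G : Graph N) (u v : Fin N) where

  contract-adj-≢ : ∀ {x y} → x ≢ u → y ≢ u → adj (contract G u v) x y ≡ adj G x y
  contract-adj-≢ {x} {y} x≢u y≢u with x ≟ u | y ≟ u
  ... | yes x≡u | _       = contradiction x≡u x≢u
  ... | no _    | yes y≡u = contradiction y≡u y≢u
  ... | no _    | no _    = refl

  contract-adj-u : ∀ {y} → y ≢ u → adj (contract G u v) u y ≡ adj G u y ∨ adj G v y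
  contract-adj-u {y} y≢u with u ≟ u | y ≟ u
  ... | no u≢u | _       = contradiction refl u≢u
  ... | yes _  | yes y≡u = contradiction y≡u y≢u
  ... | yes _  | no _    = refl

  contract-Adj-u : ∀ {y} → y ≢ u → Adj (contract G u v) u y → Adj G u y ⊎ Adj G v y
  contract-Adj-u {y} y≢u a with adj G u y | adj G v y | ≡.trans (≡.sym (contract-adj-u y≢u)) a
  ... | true  | _    | _ = inj₁ refl
  ... | false | true | _ = inj₂ refl

  contract-Walk : ∀ {x} ys {z} → x ≢ u → u ∉ ys → z ≢ u → Walk (contract G u v) x ys z → Walk G x ys z
  contract-Walk [] x≢u u∉ z≢u a = ≡.trans (≡.sym (contract-adj-≢ x≢u z≢u)) a
  contract-Walk (y ∷ ys) x≢u u∉ z≢u (a , w) =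
    ≡.trans (≡.sym (contract-adj-≢ x≢u y≢u)) a , contract-Walk ys y≢u (u∉ ∘ there) z≢u w
    where
    y≢u : y ≢ u
    y≢u y≡u = u∉ (here (≡.sym y≡u))

  -- Only the last edge of the walk touches `u`, and it stems from an edge to `u` or to `v`.
  contract-Walk-u : ∀ {x} ys → x ≢ u → u ∉ ys → Walk (contract G u v) x ys u → Walk G x ys u ⊎ Walk G x ys v
  contract-Walk-u {x} [] x≢u u∉ a
    with contract-Adj-u x≢u (≡.trans (Graph.sym (contract G u v) u x) a)
  ... | inj₁ ux = inj₁ (Adj-sym G ux)
  ... | inj₂ vx = inj₂ (Adj-sym G vx)
  contract-Walk-u (y ∷ ys) x≢u u∉ (a , w)
    with a′ ← ≡.trans (≡.sym (contract-adj-≢ x≢u (λ y≡u → u∉ (here (≡.sym y≡u))))) a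
    with contract-Walk-u ys (λ y≡u → u∉ (here (≡.sym y≡u))) (u∉ ∘ there) w
  ... | inj₁ w′ = inj₁ (a′ , w′)
  ... | inj₂ w′ = inj₂ (a′ , w′)

  -- The last clause admits `v` only when `c` passes through `u`; this is what keeps lifts of
  -- disjoint cycles disjoint.
  Lift : List (Fin N) → Set
  Lift c = ∃ λ c′ → ClosedWalk G c′ × length c ≤ length c′ × Unique c′ ×
                    (∀ {z} → z ∈ c′ → z ∈ c ⊎ (z ≡ v × u ∈ c))

  -- A cycle through the contracted vertex u is rerouted through u, v or the edge uv.
  uncontract : Adj G u v → ∀ c → ClosedWalk (contract G u v) c → 2 ≤ length c → Unique c → v ∉ c →
               Lift c
  uncontract uv c@(x ∷ xs) w 2≤ uq v∉ with any? (u ≟_) c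
  ... | no u∉ = c , contract-Walk xs x≢u (u∉ ∘ there) x≢u w , ≤-refl , uq , inj₁
    where
    x≢u : x ≢ u
    x≢u x≡u = u∉ (here (≡.sym x≡u))
  ... | yes u∈ with as , bs , eq ← ∈-∃++ u∈ = go (bs ++ as) refl
    where
    p : c ↭ u ∷ bs ++ as
    p = subst (_↭ u ∷ bs ++ as) (≡.sym eq) (++-comm as (u ∷ bs))
    w′ : ClosedWalk (contract G u v) (u ∷ bs ++ as)
    w′ = rotate (contract G u v) as bs (subst (ClosedWalk (contract G u v)) eq w)
    go : ∀ ys → ys ≡ bs ++ as → Lift c
    -- Nothing but `u` on the cycle: excluded by its length. Otherwise its first and its last edge
    -- at `u` are lifted separately.
    go [] eq′ = contradiction (subst (2 ≤_) (≡.trans (↭-length p) (cong (suc ∘ length) (≡.sym eq′))) 2≤) λ { (s≤s ()) }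
    go ys@(y ∷ zs) eq′ = reroute (contract-Adj-u y≢u uy) (contract-Walk-u zs y≢u (u∉ys ∘ there) yu)
      where
      q : c ↭ u ∷ ys
      q = subst (λ l → c ↭ u ∷ l) (≡.sym eq′) p
      uq′ : Unique (u ∷ ys)
      uq′ = Unique-resp-↭ q uq
      u∉ys : u ∉ ys
      u∉ys = Uniq.Unique[x∷xs]⇒x∉xs uq′
      y≢u : y ≢ u
      y≢u y≡u = u∉ys (here (≡.sym y≡u))
      w″ : Walk (contract G u v) u ys u
      w″ = subst (λ l → Walk (contract G u v) u l u) (≡.sym eq′) w′
      uy : Adj (contract G u v) u y
      uy = proj₁ w″
      yu : Walk (contract G u v) y zs u
      yu = proj₂ w″
      len : length c ≡ length (u ∷ ys)
      len = ↭-length q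
      v∉′ : v ∉ u ∷ ys
      v∉′ v∈ = v∉ (∈-resp-↭ (↭-sym q) v∈)
      uqᵥ : Unique (v ∷ u ∷ ys)
      uqᵥ = ∉⇒All≢ v∉′ ∷ uq′
      old : ∀ {z} → z ∈ v ∷ u ∷ ys → z ∈ c ⊎ (z ≡ v × u ∈ c)
      old (here z≡v) = inj₂ (z≡v , u∈)
      old (there z∈) = inj₁ (∈-resp-↭ (↭-sym q) z∈)
      vu↭uv : v ∷ u ∷ ys ↭ u ∷ v ∷ ys
      vu↭uv = swap v u refl
      reroute : Adj G u y ⊎ Adj G v y → Walk G y zs u ⊎ Walk G y zs v → Lift c
      reroute (inj₁ uy) (inj₁ yu) = u ∷ ys , (uy , yu) , ≤-reflexive len , uq′ , old ∘ there
      reroute (inj₁ uy) (inj₂ yv) = v ∷ u ∷ ys , (Adj-sym G uv , uy , yv) , m≤n⇒m≤1+n (≤-reflexive len) , uqᵥ , old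
      reroute (inj₂ vy) (inj₁ yu) = u ∷ v ∷ ys , (uv , vy , yu) , m≤n⇒m≤1+n (≤-reflexive len) ,
        Unique-resp-↭ vu↭uv uqᵥ , old ∘ ∈-resp-↭ (↭-sym vu↭uv)
      reroute (inj₂ vy) (inj₂ yv) = v ∷ ys , (vy , yv) , ≤-reflexive len ,
        drop-second uqᵥ , λ { (here z≡v) → old (here z≡v) ; (there z∈) → old (there (there z∈)) }
        where
        drop-second : Unique (v ∷ u ∷ ys) → Unique (v ∷ ys)
        drop-second ((_ ∷ v∉ys) ∷ _ ∷ uq) = v∉ys ∷ uq

  -- At most one of the disjoint cycles contains `u`, so at most one lift picks up `v`.
  uncontract-all : Adj G u v → ∀ {r} → 2 ≤ r → ∀ cs →
    All (λ c → ClosedWalk (contract G u v) c × r ≤ length c) cs → Unique (concat cs) → v ∉ concat cs →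
    ∃ λ cs′ → length cs′ ≡ length cs × All (λ c → ClosedWalk G c × r ≤ length c) cs′ ×
              Unique (concat cs′) × (∀ {z} → z ∈ concat cs′ → z ∈ concat cs ⊎ (z ≡ v × u ∈ concat cs))
  uncontract-all uv 2≤r [] [] _ _ = [] , refl , [] , [] , λ ()
  uncontract-all uv {r} 2≤r (c ∷ cs) ((w , r≤) ∷ ws) uq v∉
    with c′ , w′ , len , uq′ , old ← uncontract uv c w (≤-trans 2≤r r≤) (Unique-++⁻ˡ c uq) (v∉ ∘ ∈-++⁺ˡ)
    with cs′ , len′ , ws′ , uq″ , old′ ← uncontract-all uv 2≤r cs ws (Unique-++⁻ʳ c uq) (v∉ ∘ ∈-++⁺ʳ c) =
      c′ ∷ cs′ , cong suc len′ , (w′ , ≤-trans r≤ len) ∷ ws′ , Uniq.++⁺ uq′ uq″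
      (λ (z∈ , z∈′) → disjoint (old z∈) (old′ z∈′)) , within
    where
    disjoint : ∀ {z} → z ∈ c ⊎ (z ≡ v × u ∈ c) → z ∈ concat cs ⊎ (z ≡ v × u ∈ concat cs) → ⊥
    disjoint (inj₁ z∈)         (inj₁ z∈′)         = Unique-disjoint c uq z∈ z∈′
    disjoint (inj₁ z∈)         (inj₂ (refl , _))  = v∉ (∈-++⁺ˡ z∈)
    disjoint (inj₂ (refl , _)) (inj₁ z∈′)         = v∉ (∈-++⁺ʳ c z∈′)
    disjoint (inj₂ (_ , u∈))   (inj₂ (_ , u∈′))   = Unique-disjoint c uq u∈ u∈′
    within : ∀ {z} → z ∈ c′ ++ concat cs′ → z ∈ c ++ concat cs ⊎ (z ≡ v × u ∈ c ++ concat cs)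
    within z∈ with ∈-++⁻ c′ z∈
    ... | inj₁ z∈c′ = [ inj₁ ∘ ∈-++⁺ˡ , (λ (z≡v , u∈) → inj₂ (z≡v , ∈-++⁺ˡ u∈)) ]′ (old z∈c′)
    ... | inj₂ z∈cs′ = [ inj₁ ∘ ∈-++⁺ʳ c , (λ (z≡v , u∈) → inj₂ (z≡v , ∈-++⁺ʳ c u∈)) ]′ (old′ z∈cs′)

  Packing-uncontract : Adj G u v → ∀ {k r W} → 2 ≤ r → v ∉ u ∷ W →
                       Packing (contract G u v) k r (u ∷ W) → Packing G k r (u ∷ v ∷ W)
  Packing-uncontract uv {W = W} 2≤r v∉ (packing cs num cl dis wi)
    with cs′ , len , cl′ , dis′ , old ← uncontract-all uv 2≤r cs cl dis (v∉ ∘ wi) =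
      packing cs′ (≡.trans len num) cl′ dis′ (λ z∈ → [ widen ∘ wi , (λ (z≡v , _) → there (here z≡v)) ]′ (old z∈))
    where
    widen : ∀ {z} → z ∈ u ∷ W → z ∈ u ∷ v ∷ W
    widen (here e)  = here e
    widen (there i) = there (there i)

  -- Contraction loses the edge `uv` and, for each common neighbour, one of two edges that become
  -- parallel. Each lost edge is two ordered pairs.
  pairs-contract : Adj G u v → ∀ W → u ∉ W →
    pairs (adj G) (u ∷ v ∷ W) (u ∷ v ∷ W) ≡
    pairs (adj (contract G u v)) (u ∷ W) (u ∷ W) + 2 * (1 + count (common G u v) W)
  pairs-contract uv W u∉ = begin
    pairs (adj G) (u ∷ v ∷ W) (u ∷ v ∷ W)
      ≡⟨ pairs-++ G (u ∷ v ∷ []) W ⟩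
    _ ≡⟨ lhs ⟩
    2 + 2 * (count (adj G u) W + count (adj G v) W) + pairs (adj G) W W
      ≡⟨ cong (λ t → 2 + 2 * t + pairs (adj G) W W) (count-∨-∧ (adj G u) (adj G v) W) ⟨
    2 + 2 * (count (λ x → adj G u x ∨ adj G v x) W + t) + pairs (adj G) W W
      ≡⟨ cong₂ (λ s t′ → 2 + 2 * (s + t) + t′) (count-cong W λ z∈ → contract-adj-u (≢u z∈))
           (pairs-cong W W λ x∈ y∈ → contract-adj-≢ (≢u x∈) (≢u y∈)) ⟨
    2 + 2 * (s′ + t) + pairs (adj G′) W W
      ≡⟨ rearrange s′ t (pairs (adj G′) W W) ⟩
    ((0 + s′) + 0) + ((s′ + 0) + pairs (adj G′) W W) + 2 * (1 + t)
      ≡⟨ cong (λ b → ((bit b + s′) + 0) + ((s′ + 0) + pairs (adj G′) W W) + 2 * (1 + t)) (irrefl G′ u) ⟨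
    ((bit (adj G′ u u) + s′) + 0) + ((s′ + 0) + pairs (adj G′) W W) + 2 * (1 + t)
      ≡⟨ cong (_+ 2 * (1 + t)) (pairs-++ G′ (u ∷ []) W) ⟨
    pairs (adj G′) (u ∷ W) (u ∷ W) + 2 * (1 + t) ∎
    where
    open ≡.≡-Reasoning
    G′ = contract G u v
    t = count (common G u v) W
    s′ = count (adj G′ u) W
    ≢u : ∀ {z} → z ∈ W → z ≢ u
    ≢u z∈ refl = u∉ z∈
    rearrange : ∀ s t e → 2 + 2 * (s + t) + e ≡ ((0 + s) + 0) + ((s + 0) + e) + 2 * (1 + t)
    rearrange = solve-∀
    lhs′ : ∀ a b e → ((0 + (1 + a)) + ((1 + (0 + b)) + 0)) + ((a + (b + 0)) + e) ≡ 2 + 2 * (a + b) + e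
    lhs′ = solve-∀
    lhs : pairs (adj G) (u ∷ v ∷ []) (u ∷ v ∷ W) + (pairs (adj G) (u ∷ v ∷ []) W + pairs (adj G) W W)
          ≡ 2 + 2 * (count (adj G u) W + count (adj G v) W) + pairs (adj G) W W
    lhs rewrite irrefl G u | irrefl G v | uv | Adj-sym G uv =
      lhs′ (count (adj G u) W) (count (adj G v) W) (pairs (adj G) W W)

Packing-⊆ : ∀ {G : Graph N} {k r W W′} → (∀ {z} → z ∈ W → z ∈ W′) → Packing G k r W → Packing G k r W′
Packing-⊆ W⊆W′ (packing cs num cl dis wi) = packing cs num cl dis (W⊆W′ ∘ wi)

Packing-shorter : ∀ {G : Graph N} {k r s W} → r ≤ s → Packing G k s W → Packing G k r W
Packing-shorter r≤s (packing cs num cl dis wi) =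
  packing cs num (All.map (λ (w , s≤) → w , ≤-trans r≤s s≤) cl) dis wi

Packing-∷ : ∀ {G : Graph N} {k r W} c → ClosedWalk G c → r ≤ length c → Unique (c ++ W) → Unique c →
            Packing G k r W → Packing G (suc k) r (c ++ W)
Packing-∷ c w r≤ uq uqc (packing cs num cl dis wi) =
  packing (c ∷ cs) (cong suc num) ((w , r≤) ∷ cl)
    (Uniq.++⁺ uqc dis λ (z∈ , z∈′) → Unique-disjoint c uq z∈ (wi z∈′))
    (λ z∈ → [ ∈-++⁺ˡ , ∈-++⁺ʳ c ∘ wi ]′ (∈-++⁻ c z∈))

-- Alternating cycles through vertices of high degree

module _ (G : Graph N) {W : List (Fin N)} (uqW : Unique W) (H : List (Fin N))
         (rich : ∀ {x y} → x ∈ H → y ∈ H → 2 * length H ≤ 2 + count (common G x y) W) where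

  -- `H ++ U` has fewer than 2|H| entries, and `x` and `y` are two of them without being common
  -- neighbours. So it cannot contain all of the at least 2|H| - 2 common neighbours.
  link : ∀ {x y} U → x ∈ H → y ∈ H → x ≢ y → length U < length H →
         ∃ λ w → Adj G x w × Adj G w y × w ∈ W × w ∉ H × w ∉ U
  link {x} {y} U x∈ y∈ x≢y U<H =
    let w , w∈ , xy , w∉ = fresh (common G x y) (H ++ U) uqW few
        xw , yw = common⇒Adj G x y xy
    in w , xw , Adj-sym G yw , w∈ , w∉ ∘ ∈-++⁺ˡ , w∉ ∘ ∈-++⁺ʳ H
    where
    open ≤-Reasoning
    few : count (common G x y) (H ++ U) < count (common G x y) W
    few = +-cancelˡ-< 2 _ _ (begin-strict
      2 + count (common G x y) (H ++ U)
        ≤⟨ count-misses-two (common G x y) (H ++ U) x≢y (∈-++⁺ˡ x∈) (∈-++⁺ˡ y∈)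
             (common-irreflˡ G x y) (common-irreflʳ G x y) ⟩
      length (H ++ U)              ≡⟨ length-++ H ⟩
      length H + length U          <⟨ +-monoʳ-< (length H) U<H ⟩
      length H + length H          ≡⟨ cong (length H +_) (+-identityʳ (length H)) ⟨
      2 * length H                 ≤⟨ rich x∈ y∈ ⟩
      2 + count (common G x y) W   ∎)

  -- `U` collects the connecting vertices already spent on earlier links.
  Links : List (Fin N) → List (Fin N) → Set
  Links U ws = Unique ws × (∀ {w} → w ∈ ws → w ∈ W × w ∉ H × w ∉ U)

  Links-∷ : ∀ {U w ws} → w ∈ W → w ∉ H → w ∉ U → Links (w ∷ U) ws → Links U (w ∷ ws)
  Links-∷ w∈ w∉H w∉U (uq , old) =
    ∉⇒All≢ (λ w∈ws → proj₂ (proj₂ (old w∈ws)) (here refl)) ∷ uq ,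
    λ { (here refl) → w∈ , w∉H , w∉U
      ; (there z∈) → let a , b , c = old z∈ in a , b , c ∘ there }

  -- Greedy choice of one connector in each of the `suc (length hs)` gaps between `h`, the entries
  -- of `hs` and `z`. The bound reserves one unit per gap, so `U` is shorter than `H` whenever
  -- `link` is called.
  weave : ∀ h hs z U → Unique (z ∷ h ∷ hs) → (∀ {x} → x ∈ z ∷ h ∷ hs → x ∈ H) →
          length U + suc (length hs) ≤ length H →
          ∃₂ λ c ws → Walk G h c z × c ↭ hs ++ ws × length ws ≡ suc (length hs) × Links U ws
  weave h [] z U ((z≢h ∷ []) ∷ _) ⊆H room
    with w , hw , wz , w∈ , w∉H , w∉U ←
         link U (⊆H (there (here refl))) (⊆H (here refl)) (z≢h ∘ ≡.sym) (subst (_≤ length H) (+-comm (length U) 1) room) =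
      w ∷ [] , w ∷ [] , (hw , wz) , refl , refl , Links-∷ w∈ w∉H w∉U ([] , λ ())
  weave h (h′ ∷ hs) z U ((_ ∷ z∉) ∷ (h≢h′ ∷ _) ∷ uq) ⊆H room
    with w , hw , wh′ , w∈ , w∉H , w∉U ←
         link U (⊆H (there (here refl))) (⊆H (there (there (here refl)))) h≢h′
              (≤-trans (subst (_≤ length U + suc (suc (length hs))) (+-comm (length U) 1)
                              (+-monoʳ-≤ (length U) (s≤s z≤n)))
                       room)
    with c , ws , walk , p , len , links ←
         weave h′ hs z (w ∷ U) (z∉ ∷ uq) (λ { (here e) → ⊆H (here e) ; (there i) → ⊆H (there (there i)) })
               (subst (_≤ length H) (+-suc (length U) _) room) =
      w ∷ h′ ∷ c , w ∷ ws , (hw , wh′ , walk) ,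
      trans (prep w (prep h′ p)) (↭-sym (shift w (h′ ∷ hs) ws)) , cong suc len , Links-∷ w∈ w∉H w∉U links

  -- The first gap is linked separately and `weave` returns from the second vertex to the first:
  -- links need distinct ends, hence at least two vertices in `hs`.
  weaveCycle : ∀ hs U → 2 ≤ length hs → Unique hs → (∀ {x} → x ∈ hs → x ∈ H) →
               length U + length hs ≤ length H →
               ∃₂ λ c ws → ClosedWalk G c × c ↭ hs ++ ws × length ws ≡ length hs × Links U ws
  weaveCycle (h ∷ []) U (s≤s ())
  weaveCycle (h ∷ h′ ∷ hs) U _ uq@((h≢h′ ∷ _) ∷ _) ⊆H room
    with w , hw , wh′ , w∈ , w∉H , w∉U ←
         link U (⊆H (here refl)) (⊆H (there (here refl))) h≢h′
              (≤-trans (subst (_≤ length U + suc (suc (length hs))) (+-comm (length U) 1)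
                              (+-monoʳ-≤ (length U) (s≤s z≤n)))
                       room)
    with c , ws , walk , p , len , links ←
         weave h′ hs h (w ∷ U) uq ⊆H (subst (_≤ length H) (+-suc (length U) _) room) =
      h ∷ w ∷ h′ ∷ c , w ∷ ws , (hw , wh′ , walk) ,
      prep h (trans (prep w (prep h′ p)) (↭-sym (shift w (h′ ∷ hs) ws))) , cong suc len , Links-∷ w∈ w∉H w∉U links

  Woven : ℕ → ℕ → List (Fin N) → List (Fin N) → Set
  Woven k m hs U = ∃₂ λ cs ws → length cs ≡ k × All (λ c → ClosedWalk G c × 2 * m ≤ length c) cs ×
                                concat cs ↭ hs ++ ws × Links U ws

  -- Each block of `m` vertices of `H` takes `m` connectors and gives a cycle of length `2 * m`.
  -- Spent connectors plus remaining vertices stay constant in number, so the bound by `length H`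
  -- passes to the next block.
  weaveCycles : ∀ k m hs U → 2 ≤ m → length hs ≡ k * m → Unique hs → (∀ {x} → x ∈ hs → x ∈ H) →
                length U + length hs ≤ length H → Woven k m hs U
  weaveCycles zero m [] U _ _ _ _ _ = [] , [] , refl , [] , refl , [] , λ ()
  weaveCycles (suc k) m hs U 2≤m len uq ⊆H room = step
    where
    lenₜ : length (take m hs) ≡ m
    lenₜ = ≡.trans (length-take m hs) (m≤n⇒m⊓n≡m (subst (m ≤_) (≡.sym len) (m≤m+n m (k * m))))
    lenₔ : length (drop m hs) ≡ k * m
    lenₔ = ≡.trans (length-drop m hs) (≡.trans (cong (_∸ m) len) (m+n∸m≡n m (k * m)))
    split : length hs ≡ length (take m hs) + length (drop m hs)
    split = ≡.trans (cong length (≡.sym (take++drop≡id m hs))) (length-++ (take m hs))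
    take⊆ : ∀ {x} → x ∈ take m hs → x ∈ hs
    take⊆ {x} = subst (x ∈_) (take++drop≡id m hs) ∘ ∈-++⁺ˡ
    drop⊆ : ∀ {x} → x ∈ drop m hs → x ∈ hs
    drop⊆ {x} = subst (x ∈_) (take++drop≡id m hs) ∘ ∈-++⁺ʳ (take m hs)
    budget : ∀ ws → length ws ≡ length (take m hs) → length U + length hs ≡ length (ws ++ U) + length (drop m hs)
    budget ws eq = ≡.trans (cong (length U +_) (≡.trans split (cong (_+ length (drop m hs)) (≡.sym eq))))
      (≡.trans (lemma (length U) (length ws) _) (cong (_+ length (drop m hs)) (≡.sym (length-++ ws))))
      where
      lemma : ∀ a b c → a + (b + c) ≡ b + a + c
      lemma = solve-∀
    long : ∀ {c ws} → c ↭ take m hs ++ ws → length ws ≡ length (take m hs) → 2 * m ≡ length c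
    long {c} {ws} p eq = ≡.sym (≡.trans (↭-length p) (≡.trans (length-++ (take m hs))
      (≡.trans (cong₂ _+_ lenₜ (≡.trans eq lenₜ)) (cong (m +_) (≡.sym (+-identityʳ m))))))
    regroup : ∀ {ws vs} → (take m hs ++ ws) ++ (drop m hs ++ vs) ↭ hs ++ (ws ++ vs)
    regroup {ws} {vs} = begin
      (take m hs ++ ws) ++ (drop m hs ++ vs) ≡⟨ ++-assoc (take m hs) ws _ ⟩
      take m hs ++ (ws ++ (drop m hs ++ vs)) ↭⟨ ++⁺ˡ (take m hs) (shifts ws (drop m hs)) ⟩
      take m hs ++ (drop m hs ++ (ws ++ vs)) ≡⟨ ++-assoc (take m hs) (drop m hs) _ ⟨
      (take m hs ++ drop m hs) ++ (ws ++ vs) ≡⟨ cong (_++ (ws ++ vs)) (take++drop≡id m hs) ⟩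
      hs ++ (ws ++ vs) ∎
      where open PermutationReasoning
    step : Woven (suc k) m hs U
    step
      with c , ws , walk , p , len′ , uqws , old ←
           weaveCycle (take m hs) U (subst (2 ≤_) (≡.sym lenₜ) 2≤m) (Uniq.take⁺ m uq) (⊆H ∘ take⊆)
             (≤-trans (+-monoʳ-≤ (length U) (≤-trans (m≤m+n _ _) (≤-reflexive (≡.sym split)))) room)
      with cs , vs , num , cl , p′ , uqvs , old′ ←
           weaveCycles k m (drop m hs) (ws ++ U) 2≤m lenₔ (Uniq.drop⁺ m uq) (⊆H ∘ drop⊆)
             (subst (_≤ length H) (budget ws len′) room) =
        c ∷ cs , ws ++ vs , cong suc num , (walk , ≤-reflexive (long p len′)) ∷ cl ,
        trans (++⁺ p p′) regroup , Uniq.++⁺ uqws uqvs (λ (z∈ , z∈′) → proj₂ (proj₂ (old′ z∈′)) (∈-++⁺ˡ z∈)) ,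
        λ z∈ → [ old , (λ z∈′ → let x , y , z = old′ z∈′ in x , y , z ∘ ∈-++⁺ʳ ws) ]′ (∈-++⁻ ws z∈)

  Packing-woven : ∀ k m → 2 ≤ m → length H ≡ k * m → Unique H → (∀ {x} → x ∈ H → x ∈ W) → Packing G k (2 * m) W
  Packing-woven k m 2≤m len uq H⊆W
    with cs , ws , num , cl , p , uqws , old ← weaveCycles k m H [] 2≤m len uq (λ z∈ → z∈) ≤-refl =
      packing cs num cl
        (Unique-resp-↭ (↭-sym p) (Uniq.++⁺ uq uqws λ (z∈ , z∈′) → proj₁ (proj₂ (old z∈′)) z∈))
        (λ z∈ → [ H⊆W , proj₁ ∘ old ]′ (∈-++⁻ H (∈-resp-↭ p z∈)))

-- Cycles of prescribed length where edges have many common neighbours.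

grow : ∀ (G : Graph N) {L} q → Unique L →
       (∀ {x y} → x ∈ L → y ∈ L → Adj G x y → q ≤ count (common G x y) L) →
       ∀ {x y} → x ∈ L → y ∈ L → Adj G x y → ∀ l → l ≤ q →
       ∃₂ λ y ys → ClosedWalk G (x ∷ y ∷ ys) × Unique (x ∷ y ∷ ys) × length ys ≡ l ×
                   (∀ {z} → z ∈ x ∷ y ∷ ys → z ∈ L)
-- The start is degenerate: the edge walked forth and back, with no further vertices.
grow G q uq rich {x} {y} x∈ y∈ xy zero _ =
  y , [] , (xy , Adj-sym G xy) , (Adj⇒≢ G xy ∷ []) ∷ [] ∷ [] , refl ,
  λ { (here refl) → x∈ ; (there (here refl)) → y∈ }
-- The first edge `xy` has at least `q` common neighbours, more than the `l` other vertices of the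
-- cycle, so a fresh `w` fits between `x` and `y`. Then `xw` is the first edge for the next
-- insertion.
grow G q uq rich {x} x∈ y∈ xy (suc l) l<q
  with y , ys , (xy , walk) , uqc@((x≢y ∷ x∉) ∷ uqys) , len , ⊆L ← grow G q uq rich x∈ y∈ xy l (<⇒≤ l<q)
  with w , w∈ , cw , w∉ys ← fresh (common G x y) ys uq
         (≤-trans (s≤s (≤-trans (count-≤-length _ ys) (≤-reflexive len))) (≤-trans l<q (rich x∈ (⊆L (there (here refl))) xy)))
  with xw , yw ← common⇒Adj G x y cw =
    w , y ∷ ys , (xw , Adj-sym G yw , walk) ,
    (w≢ (common-irreflˡ G x y) cw ∘ ≡.sym ∷ x≢y ∷ x∉) ∷ (w≢ (common-irreflʳ G x y) cw ∷ ∉⇒All≢ w∉ys) ∷ uqys ,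
    cong suc len , λ { (here e) → ⊆L (here e) ; (there (here refl)) → w∈ ; (there (there i)) → ⊆L (there i) }
  where
  w≢ : ∀ {w y z} → common G x y z ≡ false → common G x y w ≡ true → w ≢ z
  w≢ f t refl = contradiction (≡.trans (≡.sym t) f) λ ()

-- Sums the degree bound over `xs`; the 3 and the factor 2 are those of `low`, which avoids
-- subtraction and halving.
pairs-≤-max : ∀ {A : Set} (R : A → A → Bool) {xs} ys {d} → (∀ {x} → x ∈ xs → 3 + 2 * count (R x) ys ≤ d) →
              length xs * 3 + 2 * pairs R xs ys ≤ length xs * d
pairs-≤-max R {[]} ys _ = z≤n
pairs-≤-max R {x ∷ xs} ys {d} bound =
  subst (_≤ d + length xs * d) (lemma (count (R x) ys) (length xs) (pairs R xs ys))
    (+-mono-≤ (bound (here refl)) (pairs-≤-max R {xs} ys (bound ∘ there)))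
  where
  lemma : ∀ a l b → (3 + 2 * a) + (l * 3 + 2 * b) ≡ 3 + l * 3 + 2 * (a + b)
  lemma = solve-∀

Rich : Graph N → ℕ → List (Fin N) → Set
Rich G c W = ∀ {x y} → x ∈ W → y ∈ W → Adj G x y → c ≤ count (common G x y) W

rich-or-poor : ∀ (G : Graph N) c W → Rich G c W ⊎
               ∃₂ λ x y → x ∈ W × y ∈ W × Adj G x y × count (common G x y) W < c
rich-or-poor G c W
  with any? (λ x → any? (λ y → (adj G x y Data.Bool.≟ true) ×-dec (count (common G x y) W <? c)) W) W
... | yes poor with x , x∈ , poor′ ← find poor with y , y∈ , xy , few ← find poor′ =
  inj₂ (x , y , x∈ , y∈ , xy , few)
... | no ¬poor = inj₁ λ x∈ y∈ xy → ≮⇒≥ λ few → ¬poor (lose x∈ (lose y∈ (xy , few)))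

-- The induction on the number of cycles and of vertices.

module _ {q m : ℕ} (r≤2m : 3 + q ≤ 2 * m) where

  2≤m : 2 ≤ m
  2≤m = ≮⇒≥ λ { (s≤s m≤1) → contradiction (≤-trans (≤-trans (m≤m+n 3 q) r≤2m) (*-monoʳ-≤ 2 m≤1)) λ { (s≤s (s≤s ())) } }

  -- With r = 3 + q this is the number c = km + r - 3.
  density : ℕ → ℕ
  density k = k * m + q

  module _ (G : Graph N) (k : ℕ) {W : List (Fin N)} (uqW : Unique W) (W≢[] : 1 ≤ length W)
           (dense : 2 * density (suc k) * length W ≤ pairs (adj G) W W)
           (richW : Rich G (density (suc k)) W) where

    K : ℕ
    K = suc k * m

    -- Degree at least |W|/2 + K - 1, doubled and rearranged to stay within the natural numbers.
    High : Fin N → Set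
    High x = length W + 2 * K ≤ 2 + 2 * deg G W x

    High? : ∀ x → Dec (High x)
    High? x = length W + 2 * K ≤? 2 + 2 * deg G W x

    -- The two degrees add up to at least |W| + 2K - 2, while the union of the neighbourhoods has at
    -- most |W| vertices; the excess is common.
    high-common : ∀ {x y} → High x → High y → 2 * K ≤ 2 + count (common G x y) W
    high-common {x} {y} hx hy = *-cancelˡ-≤ 2 (+-cancelˡ-≤ (2 * length W) _ _ (begin
      2 * length W + 2 * (2 * K)                           ≡⟨ lemma₁ (length W) K ⟩
      (length W + 2 * K) + (length W + 2 * K)              ≤⟨ +-mono-≤ hx hy ⟩
      (2 + 2 * deg G W x) + (2 + 2 * deg G W y)            ≡⟨ lemma₂ (deg G W x) (deg G W y) ⟩
      2 * (deg G W x + deg G W y) + 4                      ≡⟨ cong (λ t → 2 * t + 4) (count-∨-∧ (adj G x) (adj G y) W) ⟨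
      2 * (count (λ z → adj G x z ∨ adj G y z) W + t) + 4  ≤⟨ +-monoˡ-≤ 4 (*-monoʳ-≤ 2 (+-monoˡ-≤ t (count-≤-length _ W))) ⟩
      2 * (length W + t) + 4                               ≡⟨ lemma₃ (length W) t ⟩
      2 * length W + 2 * (2 + t)                           ∎))
      where
      open ≤-Reasoning
      t = count (common G x y) W
      lemma₁ : ∀ n K → 2 * n + 2 * (2 * K) ≡ (n + 2 * K) + (n + 2 * K)
      lemma₁ = solve-∀
      lemma₂ : ∀ a b → (2 + 2 * a) + (2 + 2 * b) ≡ 2 * (a + b) + 4
      lemma₂ = solve-∀
      lemma₃ : ∀ n t → 2 * (n + t) + 4 ≡ 2 * n + 2 * (2 + t)
      lemma₃ = solve-∀

    hs : List (Fin N)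
    hs = filter High? W

    hs⁻ : ∀ {x} → x ∈ hs → x ∈ W × High x
    hs⁻ = ∈-filter⁻ High?

    many-high : K ≤ length hs → Packing G (suc k) (3 + q) W
    many-high K≤ = Packing-shorter r≤2m
      (Packing-woven G uqW H (λ x∈ y∈ → subst (λ l → 2 * l ≤ _) (≡.sym lenH)
                                           (high-common (proj₂ (hs⁻ (H⊆ x∈))) (proj₂ (hs⁻ (H⊆ y∈)))))
        (suc k) m 2≤m lenH (Uniq.take⁺ K (Uniq.filter⁺ High? uqW)) (proj₁ ∘ hs⁻ ∘ H⊆))
      where
      -- Exactly K high vertices are kept, since 2K - 2 common neighbours are what `rich` demands
      -- for a list of length K.
      H = take K hs
      lenH : length H ≡ K
      lenH = ≡.trans (length-take K hs) (m≤n⇒m⊓n≡m K≤)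
      H⊆ : ∀ {x} → x ∈ H → x ∈ hs
      H⊆ {x} = subst (x ∈_) (take++drop≡id K hs) ∘ ∈-++⁺ˡ

    module _ (few : length hs < K)
             (IH : ∀ W′ → Unique W′ → 1 ≤ length W′ →
                   2 * density k * length W′ ≤ pairs (adj G) W′ W′ → Packing G k (3 + q) W′)
             {ls : List (Fin N)} (W↭ : W ↭ hs ++ ls) where

      open ≤-Reasoning

      uqls : Unique ls
      uqls = Unique-++⁻ʳ hs (Unique-resp-↭ W↭ uqW)

      ls⊆W : ∀ {x} → x ∈ ls → x ∈ W
      ls⊆W = ∈-resp-↭ (↭-sym W↭) ∘ ∈-++⁺ʳ hs

      low : ∀ {x} → x ∈ ls → 3 + 2 * deg G W x ≤ length W + 2 * K
      low x∈ = ≰⇒> λ high →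
        Unique-disjoint hs (Unique-resp-↭ W↭ uqW) (∈-filter⁺ High? (ls⊆W x∈) high) x∈

      -- At most K - 1 high vertices account for at most 2(K - 1)|W| ordered pairs, whereas density
      -- gives at least 2K|W|. So 2|W| of them lie between low vertices.
      low-edge : ∃₂ λ x y → x ∈ ls × y ∈ ls × Adj G x y
      low-edge = pairs-witness (adj G) ls ls (≤-trans W≢[] (≤-trans (m≤m+n _ _)
        (+-cancelˡ-≤ (2 * (length hs * length W)) _ _ (begin
          2 * (length hs * length W) + 2 * length W   ≡⟨ lemma (length hs) (length W) ⟩
          2 * suc (length hs) * length W              ≤⟨ *-monoˡ-≤ (length W) (*-monoʳ-≤ 2 (≤-trans few (m≤m+n K q))) ⟩
          2 * density (suc k) * length W              ≤⟨ dense ⟩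
          pairs (adj G) W W                           ≡⟨ pairs-↭ (adj G) W↭ ⟩
          pairs (adj G) (hs ++ ls) (hs ++ ls)         ≤⟨ pairs-++-≤ G hs ls ⟩
          2 * pairs (adj G) hs (hs ++ ls) + e         ≤⟨ +-monoˡ-≤ e (*-monoʳ-≤ 2 (pairs-≤-* (adj G) hs (hs ++ ls))) ⟩
          2 * (length hs * length (hs ++ ls)) + e     ≡⟨ cong (λ l → 2 * (length hs * l) + e) (↭-length W↭) ⟨
          2 * (length hs * length W) + e              ∎))))
        where
        e = pairs (adj G) ls ls
        lemma : ∀ h n → 2 * (h * n) + 2 * n ≡ 2 * (1 + h) * n
        lemma = solve-∀

      -- Of at least K + q common neighbours at most K - 1 are high.
      rich-low : Rich G (suc q) ls
      rich-low {x} {y} x∈ y∈ xy = +-cancelˡ-≤ (length hs) _ _ (begin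
        length hs + suc q              ≡⟨ +-suc (length hs) q ⟩
        suc (length hs) + q            ≤⟨ +-monoˡ-≤ q few ⟩
        density (suc k)                ≤⟨ richW (ls⊆W x∈) (ls⊆W y∈) xy ⟩
        count p W                      ≡⟨ count-↭ p W↭ ⟩
        count p (hs ++ ls)             ≡⟨ count-++ p hs ls ⟩
        count p hs + count p ls        ≤⟨ +-monoˡ-≤ (count p ls) (count-≤-length p hs) ⟩
        length hs + count p ls         ∎)
        where p = common G x y

      -- The two ends and their at least K + q common neighbours are distinct vertices, and K is at
      -- least 2. Hence deleting an r-cycle leaves a vertex for the induction.
      order : ∀ {x y} → x ∈ ls → y ∈ ls → Adj G x y → 3 + q < length W
      order {x} {y} x∈ y∈ xy = begin
        4 + q                              ≤⟨ +-monoʳ-≤ 2 (+-monoˡ-≤ q (≤-trans 2≤m (m≤m+n m (k * m)))) ⟩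
        2 + density (suc k)                ≤⟨ +-monoʳ-≤ 2 (richW (ls⊆W x∈) (ls⊆W y∈) xy) ⟩
        2 + count (common G x y) W         ≤⟨ count-misses-two (common G x y) W (Adj⇒≢ G xy) (ls⊆W x∈) (ls⊆W y∈)
                                                (common-irreflˡ G x y) (common-irreflʳ G x y) ⟩
        length W                           ∎

      -- Deleting an r-cycle of low vertices costs r(n + 2K − 3) in the degree sum; the density
      -- bound for k loses at least that much because r ≤ 2m.
      remove-low-cycle : ∀ {C W′} → W ↭ C ++ W′ → length C ≡ 3 + q → (∀ {x} → x ∈ C → x ∈ ls) →
                         2 * density k * length W′ ≤ pairs (adj G) W′ W′
      remove-low-cycle {C} {W′} W↭′ len C⊆ = +-cancelˡ-≤ (r * (r + n′ + 2 * K)) _ _ (begin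
        r * (r + n′ + 2 * K) + 2 * density k * n′
          -- The slack `q * r` is what the share `2 * density (suc k) * r` of the deleted vertices
          -- leaves after paying r(r + 2K - 3). The other cost, r for each remaining vertex, is paid
          -- by the drop of `2 * m` in the density bound.
          ≤⟨ m≤m+n _ (q * r) ⟩
        r * (r + n′ + 2 * K) + 2 * density k * n′ + q * r
          ≡⟨ lemma₁ q n′ m k ⟩
        r * n′ + (r * 3 + (2 * density (suc k) * r + 2 * density k * n′))
          ≤⟨ +-monoˡ-≤ _ (*-monoˡ-≤ n′ r≤2m) ⟩
        2 * m * n′ + (r * 3 + (2 * density (suc k) * r + 2 * density k * n′))
          ≡⟨ lemma₂ q n′ m k ⟩
        r * 3 + 2 * density (suc k) * (r + n′)
          ≡⟨ cong (λ n → r * 3 + 2 * density (suc k) * n) lenW ⟨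
        r * 3 + 2 * density (suc k) * length W
          ≤⟨ +-monoʳ-≤ (r * 3) dense ⟩
        r * 3 + pairs (adj G) W W
          ≡⟨ cong (r * 3 +_) (pairs-↭ (adj G) W↭′) ⟩
        r * 3 + pairs (adj G) (C ++ W′) (C ++ W′)
          ≤⟨ +-monoʳ-≤ (r * 3) (pairs-++-≤ G C W′) ⟩
        r * 3 + (2 * pairs (adj G) C (C ++ W′) + e)
          ≡⟨ +-assoc (r * 3) _ e ⟨
        r * 3 + 2 * pairs (adj G) C (C ++ W′) + e
          ≤⟨ +-monoˡ-≤ e loss ⟩
        r * (r + n′ + 2 * K) + e ∎)
        where
        r = 3 + q
        n′ = length W′
        e = pairs (adj G) W′ W′
        lenW : length W ≡ r + n′
        lenW = ≡.trans (↭-length W↭′) (≡.trans (length-++ C) (cong (_+ n′) len))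
        loss : r * 3 + 2 * pairs (adj G) C (C ++ W′) ≤ r * (r + n′ + 2 * K)
        loss = subst (λ l → l * 3 + 2 * pairs (adj G) C (C ++ W′) ≤ l * (r + n′ + 2 * K)) len
          (pairs-≤-max (adj G) (C ++ W′) λ {x} x∈ →
            subst₂ (λ d n → 3 + 2 * d ≤ n + 2 * K) (count-↭ (adj G x) W↭′) lenW (low (C⊆ x∈)))
        lemma₁ : ∀ q n m k → (3 + q) * ((3 + q) + n + 2 * (m + k * m)) + 2 * (k * m + q) * n + q * (3 + q)
                 ≡ (3 + q) * n + ((3 + q) * 3 + (2 * (m + k * m + q) * (3 + q) + 2 * (k * m + q) * n))
        lemma₁ = solve-∀
        lemma₂ : ∀ q n m k → 2 * m * n + ((3 + q) * 3 + (2 * (m + k * m + q) * (3 + q) + 2 * (k * m + q) * n))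
                 ≡ (3 + q) * 3 + 2 * (m + k * m + q) * ((3 + q) + n)
        lemma₂ = solve-∀

      few-high : Packing G (suc k) (3 + q) W
      few-high
        with x , y , x∈ , y∈ , xy ← low-edge
        -- Inserting `suc q` vertices into the closed walk on two gives exactly r = 3 + q, the
        -- length for which the deletion is accounted.
        with z , zs , walk , uqC , len , C⊆ ← grow G (suc q) uqls rich-low x∈ y∈ xy (suc q) ≤-refl
        with W′ , W↭′ ← complement (x ∷ z ∷ zs) uqC (ls⊆W ∘ C⊆) =
          Packing-⊆ (∈-resp-↭ (↭-sym W↭′))
            (Packing-∷ (x ∷ z ∷ zs) walk (≤-reflexive (≡.sym lenC)) (Unique-resp-↭ W↭′ uqW) uqC
              (IH W′ (Unique-++⁻ʳ (x ∷ z ∷ zs) (Unique-resp-↭ W↭′ uqW)) nonempty (remove-low-cycle W↭′ lenC C⊆)))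
        where
        lenC : length (x ∷ z ∷ zs) ≡ 3 + q
        lenC = cong (2 +_) len
        nonempty : 1 ≤ length W′
        nonempty = +-cancelˡ-≤ (3 + q) _ _ (begin
          3 + q + 1                          ≡⟨ +-comm (3 + q) 1 ⟩
          4 + q                              ≤⟨ order x∈ y∈ xy ⟩
          length W                           ≡⟨ ↭-length W↭′ ⟩
          length ((x ∷ z ∷ zs) ++ W′)        ≡⟨ length-++ (x ∷ z ∷ zs) ⟩
          length (x ∷ z ∷ zs) + length W′    ≡⟨ cong (_+ length W′) lenC ⟩
          3 + q + length W′                  ∎)

    rich-step : (∀ W′ → Unique W′ → 1 ≤ length W′ →
                 2 * density k * length W′ ≤ pairs (adj G) W′ W′ → Packing G k (3 + q) W′) →
                Packing G (suc k) (3 + q) W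
    rich-step IH with K ≤? length hs
    ... | yes K≤ = many-high K≤
    ... | no K≰ = few-high (≰⇒> K≰) IH (proj₂ (complement hs (Uniq.filter⁺ High? uqW) (proj₁ ∘ hs⁻)))

  -- One vertex fewer lowers the bound by `2 * c`, and at most c edges are lost: the contracted one
  -- and one per common neighbour, of which there are fewer than c.
  contract-dense : ∀ (G : Graph N) {c n} {W : List (Fin N)} {x y W₀} → length W ≡ suc n → W ↭ x ∷ y ∷ W₀ → x ∉ W₀ →
              2 * c * suc n ≤ pairs (adj G) W W → Adj G x y → count (common G x y) W < c →
              2 * c * n ≤ pairs (adj (contract G x y)) (x ∷ W₀) (x ∷ W₀)
  contract-dense G {c} {n} {W} {x} {y} {W₀} len W↭ x∉ dense xy few = +-cancelʳ-≤ (2 * c) _ _ (begin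
    2 * c * n + 2 * c                           ≡⟨ lemma c n ⟩
    2 * c * suc n                               ≤⟨ dense ⟩
    pairs (adj G) W W                           ≡⟨ pairs-↭ (adj G) W↭ ⟩
    pairs (adj G) (x ∷ y ∷ W₀) (x ∷ y ∷ W₀)     ≡⟨ pairs-contract G x y xy W₀ x∉ ⟩
    e + 2 * (1 + count (common G x y) W₀)       ≤⟨ +-monoʳ-≤ e (*-monoʳ-≤ 2 (≤-trans (s≤s fewer) few)) ⟩
    e + 2 * c                                   ∎)
    where
    open ≤-Reasoning
    e = pairs (adj (contract G x y)) (x ∷ W₀) (x ∷ W₀)
    fewer : count (common G x y) W₀ ≤ count (common G x y) W
    fewer = subst (count (common G x y) W₀ ≤_) (≡.sym (count-↭ (common G x y) W↭))
      (≤-trans (m≤n+m _ (bit (common G x y y))) (m≤n+m _ (bit (common G x y x))))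
    lemma : ∀ c n → 2 * c * n + 2 * c ≡ 2 * c * (1 + n)
    lemma = solve-∀

  poor-step : ∀ (G : Graph N) {c k n W} → length W ≡ suc n → Unique W → 2 * c * suc n ≤ pairs (adj G) W W →
              (∀ G′ W′ → length W′ ≡ n → Unique W′ → 1 ≤ n →
               2 * c * n ≤ pairs (adj G′) W′ W′ → Packing G′ k (3 + q) W′) →
              ∀ {x y} → x ∈ W → y ∈ W → Adj G x y → count (common G x y) W < c → Packing G k (3 + q) W
  poor-step G {n = n} len uq dense IH {x} {y} x∈ y∈ xy few
    with W₀ , W↭ ← complement (x ∷ y ∷ []) ((Adj⇒≢ G xy ∷ []) ∷ [] ∷ [])
                     (λ { (here refl) → x∈ ; (there (here refl)) → y∈ })
    with (x≢y ∷ x∉W₀) ∷ uqy@(_ ∷ uq₀) ← Unique-resp-↭ W↭ uq =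
      Packing-⊆ (∈-resp-↭ (↭-sym W↭))
        (Packing-uncontract G x y xy (s≤s (s≤s z≤n)) y∉
          (IH (contract G x y) (x ∷ W₀) len₀ (x∉W₀ ∷ uq₀) (subst (1 ≤_) len₀ (s≤s z≤n))
            (contract-dense G len W↭ (λ x∈ → All.lookup x∉W₀ x∈ refl) dense xy few)))
      where
      len₀ : length (x ∷ W₀) ≡ n
      len₀ = suc-injective (≡.trans (≡.sym (↭-length W↭)) len)
      y∉ : y ∉ x ∷ W₀
      y∉ (here y≡x) = x≢y (≡.sym y≡x)
      y∉ (there y∈) = Uniq.Unique[x∷xs]⇒x∉xs uqy y∈

  -- Lexicographic induction: contraction keeps `k` and lowers `n`, deleting a cycle lowers `k` and
  -- leaves `n` arbitrary. The bound `1 ≤ n` matters because the density condition is vacuous on no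
  -- vertices.
  dense⇒Packing : ∀ k n (G : Graph N) W → length W ≡ n → Unique W → 1 ≤ n →
                  2 * density k * n ≤ pairs (adj G) W W → Packing G k (3 + q) W
  dense⇒Packing zero n G W _ _ _ _ = packing [] refl [] [] λ ()
  dense⇒Packing (suc k) (suc n) G W len uq _ dense =
    [ (λ (rich : Rich G (density (suc k)) W) → rich-step G k uq (subst (1 ≤_) (≡.sym len) (s≤s z≤n))
        (subst (λ l → 2 * density (suc k) * l ≤ pairs (adj G) W W) (≡.sym len) dense) rich
        (λ W′ → dense⇒Packing k (length W′) G W′ refl))
    , (λ (_ , _ , x∈ , y∈ , xy , few) →
        poor-step G len uq dense (dense⇒Packing (suc k) n) x∈ y∈ xy few)
    ]′ (rich-or-poor G (density (suc k)) W)

-- Translation to the graph notions of the statement.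

length-filter-product : ∀ (R : Fin N → Fin N → Bool) xs ys →
  length (filter (λ p → R (proj₁ p) (proj₂ p) Data.Bool.≟ true) (cartesianProduct xs ys)) ≡ pairs R xs ys
length-filter-product R [] ys = refl
length-filter-product {N} R (x ∷ xs) ys = ≡.trans (cong length (filter-++ R? (map (x ,_) ys) _))
  (≡.trans (length-++ (filter R? (map (x ,_) ys))) (cong₂ _+_ (row ys) (length-filter-product R xs ys)))
  where
  R? : (p : Fin N × Fin N) → Dec (R (proj₁ p) (proj₂ p) ≡ true)
  R? p = R (proj₁ p) (proj₂ p) Data.Bool.≟ true
  row : ∀ ys → length (filter R? (map (x ,_) ys)) ≡ count (R x) ys
  row [] = refl
  row (y ∷ ys) with R x y
  ... | true  = cong suc (row ys)
  ... | false = row ys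

pairs-+-≤ : ∀ {A : Set} {R S T : A → A → Bool} → (∀ x y → bit (R x y) + bit (S x y) ≤ bit (T x y)) →
            ∀ xs ys → pairs R xs ys + pairs S xs ys ≤ pairs T xs ys
pairs-+-≤ le [] ys = z≤n
pairs-+-≤ {A} {R} {S} {T} le (x ∷ xs) ys =
  subst (_≤ pairs T (x ∷ xs) ys) (interchange (count (R x) ys) _ _ _) (+-mono-≤ (row ys) (pairs-+-≤ le xs ys))
  where
  row : ∀ ys → count (R x) ys + count (S x) ys ≤ count (T x) ys
  row [] = z≤n
  row (y ∷ ys) = subst (_≤ count (T x) (y ∷ ys)) (interchange (bit (R x y)) _ _ _) (+-mono-≤ (le x y) (row ys))

-- `edges` lists each edge with its smaller end first. Together with the reversed pairs nothing is
-- counted twice, as `x < y` and `y < x` exclude each other.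
2*numEdges≤pairs : ∀ (G : Graph N) → 2 * numEdges G ≤ pairs (adj G) (allFin N) (allFin N)
2*numEdges≤pairs {N} G = begin
  2 * numEdges G                    ≡⟨ cong (2 *_) (length-filter-product R V V) ⟩
  2 * pairs R V V                   ≡⟨ cong (pairs R V V +_) (≡.trans (+-identityʳ _) (pairs-flip R V V)) ⟩
  pairs R V V + pairs (flip R) V V  ≤⟨ pairs-+-≤ once V V ⟩
  pairs (adj G) V V                 ∎
  where
  open ≤-Reasoning
  V = allFin N
  R : Fin N → Fin N → Bool
  R x y = ⌊ x <ᶠ? y ⌋ ∧ adj G x y
  once : ∀ x y → bit (R x y) + bit (R y x) ≤ bit (adj G x y)
  once x y rewrite Graph.sym G y x with x <ᶠ? y | y <ᶠ? x | adj G x y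
  ... | yes x<y | yes y<x | _     = contradiction y<x (<-asym x<y)
  ... | yes _   | no _    | true  = ≤-refl
  ... | yes _   | no _    | false = z≤n
  ... | no _    | yes _   | true  = ≤-refl
  ... | no _    | yes _   | false = z≤n
  ... | no _    | no _    | _     = z≤n

Walk⇒Path : ∀ (G : Graph N) x xs {z} → Walk G x xs z →
            Path G (x ∷ xs) × ∃ λ b → last (x ∷ xs) ≡ just b × Adj G b z
Walk⇒Path G x [] a = one x , x , refl , a
Walk⇒Path G x (y ∷ ys) (a , w) with p , b , eq , bz ← Walk⇒Path G y ys w = cons x y ys a p , b , eq , bz

ClosedWalk⇒IsCycle : ∀ (G : Graph N) c → ClosedWalk G c → 3 ≤ length c → Unique c → IsCycle G c
ClosedWalk⇒IsCycle G (x ∷ xs) w 3≤ uq with p , b , eq , bx ← Walk⇒Path G x xs w = record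
  { len≥3 = 3≤ ; distinct = uq ; path = p ; closing = x , b , refl , eq , bx }

Unique-concat⁻ : ∀ {A : Set} (xss : List (List A)) i → Unique (concat xss) → Unique (lookup xss i)
Unique-concat⁻ (xs ∷ xss) zero    uq = Unique-++⁻ˡ xs uq
Unique-concat⁻ (xs ∷ xss) (suc i) uq = Unique-concat⁻ xss i (Unique-++⁻ʳ xs uq)

Packing⇒DisjointLongCycles : ∀ {G : Graph N} {k r W} → 3 ≤ r → Packing G k r W → DisjointLongCycles G k r
Packing⇒DisjointLongCycles {G = G} 3≤r (packing cs refl cl uq _) = record
  { cycles   = lookup cs
  ; isCycle  = λ i → ClosedWalk⇒IsCycle G (lookup cs i) (proj₁ (good i)) (≤-trans 3≤r (proj₂ (good i))) (Unique-concat⁻ cs i uq)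
  ; long     = λ i → proj₂ (good i)
  -- Looking up all indices in order gives back the list `cs`.
  ; disjoint = subst (Unique ∘ concat) (≡.sym (≡.trans (map-tabulate (λ i → i) (lookup cs)) (tabulate-lookup cs))) uq
  }
  where
  good = λ i → All.lookup cl (∈-lookup {xs = cs} i)

n≤2*⌈n/2⌉ : ∀ n → n ≤ 2 * ⌈ n /2⌉
n≤2*⌈n/2⌉ n = subst₂ _≤_ (⌊n/2⌋+⌈n/2⌉≡n n) (cong (⌈ n /2⌉ +_) (≡.sym (+-identityʳ _))) (+-monoˡ-≤ ⌈ n /2⌉ (⌊n/2⌋≤⌈n/2⌉ n))

2*⌈n/2⌉≤1+n : ∀ n → 2 * ⌈ n /2⌉ ≤ 1 + n
2*⌈n/2⌉≤1+n n = subst₂ _≤_ (cong (⌈ n /2⌉ +_) (≡.sym (+-identityʳ _))) (⌊n/2⌋+⌈n/2⌉≡n (suc n))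
  (+-monoʳ-≤ ⌈ n /2⌉ (⌊n/2⌋≤⌈n/2⌉ (suc n)))

-- This is where k ≥ 6 is needed.
density-≤ : ∀ k q {m} → 6 ≤ k → 2 * m ≤ 4 + q → 3 * (2 * (k * m + q)) ≤ 4 * k * (3 + q)
density-≤ k q {m} 6≤k 2m≤ = begin
  3 * (2 * (k * m + q))        ≡⟨ lemma₁ k m q ⟩
  3 * k * (2 * m) + 6 * q      ≤⟨ +-mono-≤ (*-monoʳ-≤ (3 * k) 2m≤) (*-monoˡ-≤ q 6≤k) ⟩
  3 * k * (4 + q) + k * q      ≡⟨ lemma₂ k q ⟩
  4 * k * (3 + q)              ∎
  where
  open ≤-Reasoning
  lemma₁ : ∀ k m q → 3 * (2 * (k * m + q)) ≡ 3 * k * (2 * m) + 6 * q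
  lemma₁ = solve-∀
  lemma₂ : ∀ k q → 3 * k * (4 + q) + k * q ≡ 4 * k * (3 + q)
  lemma₂ = solve-∀

theorem1 : (k r : ℕ) → 6 ≤ k → 3 ≤ r →
    (n : ℕ) → .{{_ : NonZero n}} → (G : Graph n) →
    4 * k * r * n ≤ 3 * (2 * numEdges G) →
    DisjointLongCycles G k r
theorem1 k (suc (suc (suc q))) 6≤k 3≤r@(s≤s (s≤s (s≤s _))) (suc n) G dense =
  Packing⇒DisjointLongCycles 3≤r
    -- This argument fixes m = ⌈r/2⌉, the least value with r ≤ 2m.
    (dense⇒Packing (n≤2*⌈n/2⌉ (3 + q)) k (suc n) G (allFin (suc n)) (length-tabulate (λ i → i))
      (Uniq.allFin⁺ (suc n)) (s≤s z≤n) (*-cancelˡ-≤ 3 (begin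
        3 * (2 * d * suc n)       ≡⟨ *-assoc 3 (2 * d) (suc n) ⟨
        3 * (2 * d) * suc n       ≤⟨ *-monoˡ-≤ (suc n) (density-≤ k q 6≤k (2*⌈n/2⌉≤1+n (3 + q))) ⟩
        4 * k * (3 + q) * suc n   ≤⟨ dense ⟩
        3 * (2 * numEdges G)      ≤⟨ *-monoʳ-≤ 3 (2*numEdges≤pairs G) ⟩
        3 * pairs (adj G) (allFin (suc n)) (allFin (suc n)) ∎)))
  where
  open ≤-Reasoning
  d = k * ⌈ 3 + q /2⌉ + q
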